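{- For $n\ge 2$ let $G_n$ be the intersection graph of the $\binom{n}{2}$ closed intervals $[i,j]$, $1\le i<j\le n$. Then $c(G_n)\le p(G_n)\le \log n+1$, where $\log$ is base $2$.
   Context: A comparability graph is a graph admitting a transitive orientation. $p(G)$ is the minimum number $m$ such that $E(G)$ is the union of the edge sets of $m$ pairwise edge-disjoint comparability subgraphs of $G$; $c(G)$ is the minimum number of comparability subgraphs of $G$ (not necessarily edge-disjoint) whose edge sets cover $E(G)$. -}

module Defs where

open import Data.Fin.Base using (Fin)
import Data.Integer.Base as ℤ
import Data.Integer.Properties as ℤ
open import Data.Nat.Base using (ℕ; _≤_; _<_; _⊔_)
import Data.Nat.Coprimality as Coprimality
import Data.Nat.Properties as ℕ
open import Data.Product.Base using (_×_; _,_; ∃-syntax)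
open import Data.Rational.Base as ℚ using (ℚ; _/_)
import Data.Rational.Properties as ℚ
open import Data.Sum.Base using (_⊎_)
open import Level using (0ℓ)
open import Relation.Binary.Core using (Rel)
open import Relation.Binary.Definitions
  using (Asymmetric; Decidable; DecidableEquality; Irreflexive; Symmetric; Transitive)
open import Relation.Binary.PropositionalEquality
  using (_≡_; _≢_; refl; sym; cong; subst₂)
open import Relation.Nullary.Decidable using (_×-dec_; ¬?; map′)
open import Relation.Nullary.Negation using (¬_)

------------------------------------------------------------------------
-- Simple graphs

record Graph (V : Set) : Set₁ where
  field
    Edge   : Rel V 0ℓ
    irrefl : Irreflexive _≡_ Edge
    symm   : Symmetric Edge
    edge?  : Decidable Edge

open Graph public

-- Subgraphs are taken to be spanning: adding isolated vertices to a graph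
-- changes neither its edges nor whether it has a transitive orientation.

infix 4 _⊑_

_⊑_ : ∀ {V} → Graph V → Graph V → Set
H ⊑ G = ∀ {u v} → Edge H u v → Edge G u v

------------------------------------------------------------------------
-- Comparability graphs

record TransitiveOrientation {V} (G : Graph V) : Set₁ where
  field
    _⇒_    : Rel V 0ℓ
    sound  : ∀ {u v} → u ⇒ v → Edge G u v
    orient : ∀ {u v} → Edge G u v → u ⇒ v ⊎ v ⇒ u
    asym   : Asymmetric _⇒_
    trans  : Transitive _⇒_

Comparability : ∀ {V} → Graph V → Set₁
Comparability = TransitiveOrientation

------------------------------------------------------------------------
-- The invariants c and p

record ComparabilityCover {V} (G : Graph V) (m : ℕ) : Set₁ where
  field
    part          : Fin m → Graph V
    subgraph      : ∀ k → part k ⊑ G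
    comparability : ∀ k → Comparability (part k)
    covers        : ∀ {u v} → Edge G u v → ∃[ k ] Edge (part k) u v

record ComparabilityPartition {V} (G : Graph V) (m : ℕ) : Set₁ where
  field
    cover : ComparabilityCover G m
  open ComparabilityCover cover public
  field
    disjoint : ∀ {k l} → k ≢ l → ∀ {u v} → Edge (part k) u v → ¬ Edge (part l) u v

IsMinimum : ∀ {ℓ} → (ℕ → Set ℓ) → ℕ → Set ℓ
IsMinimum P m = P m × (∀ k → P k → m ≤ k)

-- IsC G m says c(G) = m, and IsP G m says p(G) = m.

IsC : ∀ {V} → Graph V → ℕ → Set₁
IsC G = IsMinimum (ComparabilityCover G)

IsP : ∀ {V} → Graph V → ℕ → Set₁
IsP G = IsMinimum (ComparabilityPartition G)

------------------------------------------------------------------------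
-- The intervals [i , j] with 1 ≤ i < j ≤ n

record Interval (n : ℕ) : Set where
  constructor interval
  field
    lo    : ℕ
    hi    : ℕ
    1≤lo  : 1 ≤ lo
    lo<hi : lo < hi
    hi≤n  : hi ≤ n

open Interval public

ι : ℕ → ℚ
ι k = ℤ.+ k / 1

-- Points are rational rather than real. Since the endpoints are integers,
-- two of these intervals share a real point iff they share a rational one.

infix 4 _∈ᴵ_

_∈ᴵ_ : ∀ {n} → ℚ → Interval n → Set
x ∈ᴵ I = ι (lo I) ℚ.≤ x × x ℚ.≤ ι (hi I)

Intersect : ∀ {n} → Rel (Interval n) 0ℓ
Intersect I J = ∃[ x ] (x ∈ᴵ I × x ∈ᴵ J)

≡-interval : ∀ {n} {I J : Interval n} → lo I ≡ lo J → hi I ≡ hi J → I ≡ J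
≡-interval {I = interval i j a b c} {interval .i .j a′ b′ c′} refl refl
  with refl ← ℕ.≤-irrelevant a a′
     | refl ← ℕ.≤-irrelevant b b′
     | refl ← ℕ.≤-irrelevant c c′ = refl

_≟ᴵ_ : ∀ {n} → DecidableEquality (Interval n)
I ≟ᴵ J = map′ (λ (p , q) → ≡-interval p q) (λ p → cong lo p , cong hi p)
              (lo I ℕ.≟ lo J ×-dec hi I ℕ.≟ hi J)

ι-normal : ∀ k → ι k ≡ ℚ.mkℚ (ℤ.+ k) 0 (Coprimality.sym (Coprimality.1-coprimeTo k))
ι-normal k = ℚ.normalize-coprime (Coprimality.sym (Coprimality.1-coprimeTo k))

ι-mono-≤ : ∀ {i j} → i ≤ j → ι i ℚ.≤ ι j
ι-mono-≤ {i} {j} i≤j = subst₂ ℚ._≤_ (sym (ι-normal i)) (sym (ι-normal j))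
  (ℚ.*≤* (ℤ.*-monoʳ-≤-nonNeg (ℤ.+ 1) (ℤ.+≤+ i≤j)))

ι-cancel-≤ : ∀ {i j} → ι i ℚ.≤ ι j → i ≤ j
ι-cancel-≤ {i} {j} p = ℤ.drop‿+≤+ (ℤ.*-cancelʳ-≤-pos (ℤ.+ i) (ℤ.+ j) (ℤ.+ 1)
  (ℚ.drop-*≤* (subst₂ ℚ._≤_ (ι-normal i) (ι-normal j) p)))

intersect-sym : ∀ {n} (I J : Interval n) → Intersect I J → Intersect J I
intersect-sym I J (x , x∈I , x∈J) = x , x∈J , x∈I

intersect⁺ : ∀ {n} (I J : Interval n) → lo I ≤ hi J × lo J ≤ hi I → Intersect I J
intersect⁺ I J (p , q) = ι (lo I ⊔ lo J)
  , (ι-mono-≤ (ℕ.m≤m⊔n (lo I) (lo J)) , ι-mono-≤ (ℕ.⊔-lub (ℕ.<⇒≤ (lo<hi I)) q))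
  , (ι-mono-≤ (ℕ.m≤n⊔m (lo I) (lo J)) , ι-mono-≤ (ℕ.⊔-lub p (ℕ.<⇒≤ (lo<hi J))))

intersect⁻ : ∀ {n} (I J : Interval n) → Intersect I J → lo I ≤ hi J × lo J ≤ hi I
intersect⁻ I J (x , (a , b) , (c , d)) =
  ι-cancel-≤ (ℚ.≤-trans a d) , ι-cancel-≤ (ℚ.≤-trans c b)

intersect? : ∀ {n} → Decidable (Intersect {n})
intersect? I J = map′ (intersect⁺ I J) (intersect⁻ I J)
                      (lo I ℕ.≤? hi J ×-dec lo J ℕ.≤? hi I)

------------------------------------------------------------------------
-- The intersection graph of these intervals

intervalGraph : ∀ n → Graph (Interval n)
intervalGraph n = record
  { Edge   = λ I J → I ≢ J × Intersect I J
  ; irrefl = λ { refl (I≢I , _) → I≢I refl }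
  ; symm   = λ { {I} {J} (I≢J , x) → (λ J≡I → I≢J (sym J≡I)) , intersect-sym I J x }
  ; edge?  = λ I J → ¬? (I ≟ᴵ J) ×-dec intersect? I J
  }

{-# OPTIONS --safe #-}

-- Upper bound: halve both endpoints of an interval until they agree. The last
-- step before they agree is the level of the interval. Two intervals of the
-- same level meet iff their endpoints halve to the same number, so the edges
-- inside levels form a disjoint union of cliques, and they make up part 0. An
-- edge between different levels goes into the part numbered by the larger
-- level; this part is bipartite, and it is never part 0. There are
-- ⌊log₂ n⌋ + 1 levels.
--
-- Existence of the minima c and p: the vertex set is finite, and a transitive
-- orientation is automatically a decidable relation, so whether a cover or a
-- partition of a given size exists is decided by searching through families of
-- binary relations.

module Submission where

open import Defs
open import Data.Fin.Base using (Fin; toℕ; fromℕ<; combine; remQuot)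
import Data.Fin.Properties as Fin
open import Data.Fin.Subset using (Subset; _∈_)
open import Data.Fin.Subset.Properties using (_∈?_; anySubset?)
open import Data.Nat.Base
  using (ℕ; zero; suc; _≤_; _<_; _+_; _*_; _∸_; _⊔_; ⌊_/2⌋; z≤n; s≤s)
open import Data.Nat.Logarithm using (⌊log₂_⌋; ⌊log₂⌊n/2⌋⌋≡⌊log₂n⌋∸1; ⌊log₂⌋-mono-≤)
import Data.Nat.Properties as ℕ
open import Data.Product.Base using (_×_; _,_; ∃-syntax; proj₁; proj₂)
open import Data.Sum.Base as Sum using (_⊎_; inj₁; inj₂; swap)
open import Data.Vec.Base using (tabulate)
open import Data.Vec.Properties using (lookup∘tabulate; []=⇒lookup; lookup⇒[]=)
open import Function.Base using (_∘_)
open import Function.Bundles using (_↪_; module RightInverse; mk↪)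
open import Function.Properties.RightInverse using (to-from)
open import Level using (0ℓ)
open import Relation.Binary.Core using (Rel)
open import Relation.Binary.Definitions
  using (Asymmetric; Decidable; Transitive; tri<; tri≈; tri>)
open import Relation.Binary.PropositionalEquality
  using (_≡_; _≢_; refl; sym; trans; cong; cong₂; subst)
open import Relation.Nullary.Decidable
  using (Dec; yes; no; does; dec-true; map′; ¬?; _×-dec_; _⊎-dec_; _→-dec_)
open import Relation.Nullary.Negation using (¬_; contradiction)
import Relation.Unary as U

-- Least witnesses and decidable subsets.

least : ∀ {ℓ} {P : ℕ → Set ℓ} → U.Decidable P → ∀ {m} → P m → ∃[ k ] IsMinimum P k
least P? {m} Pm with P? 0
... | yes P0 = 0 , P0 , λ _ _ → z≤n
least P? {zero}  Pm | no ¬P0 = contradiction Pm ¬P0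
least P? {suc m} Pm | no ¬P0 with k , Pk , min ← least (P? ∘ suc) Pm =
  suc k , Pk , λ { zero P0 → contradiction P0 ¬P0 ; (suc j) Pj → s≤s (min j Pj) }

module _ {n} {P : Fin n → Set} (P? : U.Decidable P) where

  select : Subset n
  select = tabulate (does ∘ P?)

  ∈-select⁺ : ∀ {i} → P i → i ∈ select
  ∈-select⁺ {i} p = lookup⇒[]= i select (trans (lookup∘tabulate _ i) (dec-true (P? i) p))

  ∈-select⁻ : ∀ {i} → i ∈ select → P i
  ∈-select⁻ {i} i∈ with P? i | trans (sym (lookup∘tabulate (does ∘ P?) i)) ([]=⇒lookup i∈)
  ... | yes p | _  = p
  ... | no  _ | ()

-- Deciding whether covers and partitions exist

Family : Set → ℕ → Set₁
Family V m = Fin m → Rel V 0ℓ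

-- A cover stripped to its orientations: each part is recovered as the symmetric closure of its
-- relation. Unlike `ComparabilityCover`, this lives in `Set`.
record Orients {V m} (G : Graph V) (R : Family V m) : Set where
  field
    sound      : ∀ k {u v} → R k u v → Edge G u v
    asym       : ∀ k → Asymmetric (R k)
    transitive : ∀ k → Transitive (R k)
    covers     : ∀ {u v} → Edge G u v → ∃[ k ] (R k u v ⊎ R k v u)

-- Symmetrising only the second relation suffices: swapping the endpoints reduces the other case to
-- this one.
Disjoint : ∀ {V m} → Family V m → Set
Disjoint R = ∀ k l → k ≢ l → ∀ {u v} → R k u v → ¬ (R l u v ⊎ R l v u)

module _ {V : Set} {m : ℕ} {G : Graph V} where

  module _ (C : ComparabilityCover G m) where
    open ComparabilityCover C
    private module T k = TransitiveOrientation (comparability k)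

    orientation : Family V m
    orientation k = T._⇒_ k

    -- On an edge of the part, `orient` gives one direction and `asym` excludes the other; off the
    -- edges, `sound` excludes both.
    orientation? : ∀ k → Decidable (orientation k)
    orientation? k u v with edge? (part k) u v
    ... | no  ¬e = no (¬e ∘ T.sound k)
    ... | yes e with T.orient k e
    ...   | inj₁ u⇒v = yes u⇒v
    ...   | inj₂ v⇒u = no (T.asym k v⇒u)

    cover⇒orients : Orients G orientation
    cover⇒orients = record
      { sound      = λ k → subgraph k ∘ T.sound k
      ; asym       = λ k → T.asym k
      ; transitive = λ k → T.trans k
      ; covers     = λ e → let k , e′ = covers e in k , T.orient k e′
      }

    oriented⇒edge : ∀ k {u v} → orientation k u v ⊎ orientation k v u → Edge (part k) u v
    oriented⇒edge k (inj₁ p) = T.sound k p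
    oriented⇒edge k (inj₂ p) = symm (part k) (T.sound k p)

  partition⇒disjoint : (P : ComparabilityPartition G m) →
    Disjoint (orientation (ComparabilityPartition.cover P))
  partition⇒disjoint P k l k≢l p q =
    disjoint k≢l (oriented⇒edge cover k (inj₁ p)) (oriented⇒edge cover l q)
    where open ComparabilityPartition P

  module _ {R : Family V m} (R? : ∀ k → Decidable (R k)) (O : Orients G R) where
    open Orients O

    orients⇒cover : ComparabilityCover G m
    orients⇒cover = record
      { part = λ k → record
        { Edge   = λ u v → R k u v ⊎ R k v u
        ; irrefl = λ { refl (inj₁ p) → asym k p p ; refl (inj₂ p) → asym k p p }
        ; symm   = swap
        ; edge?  = λ u v → R? k u v ⊎-dec R? k v u
        }
      ; subgraph = λ { k (inj₁ p) → sound k p ; k (inj₂ p) → symm G (sound k p) }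
      ; comparability = λ k → record
        { _⇒_    = R k
        ; sound  = inj₁
        ; orient = λ e → e
        ; asym   = asym k
        ; trans  = transitive k
        }
      ; covers = covers
      }

    orients⇒partition : Disjoint R → ComparabilityPartition G m
    orients⇒partition disj = record
      { cover    = orients⇒cover
      ; disjoint = λ { {k} {l} k≢l (inj₁ p) q → disj k l k≢l p q
                     ; {k} {l} k≢l (inj₂ p) q → disj k l k≢l p (swap q) }
      }

  module _ {R S : Family V m}
           (R⇒S : ∀ k {u v} → R k u v → S k u v) (S⇒R : ∀ k {u v} → S k u v → R k u v) where

    -- Encoding a family as a subset and decoding it preserves the relations only up to logical
    -- equivalence, so their properties have to be transported.
    orients-resp : Orients G R → Orients G S
    orients-resp O = record
      { sound      = λ k → sound k ∘ S⇒R k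
      ; asym       = λ k p q → asym k (S⇒R k p) (S⇒R k q)
      ; transitive = λ k p q → R⇒S k (transitive k (S⇒R k p) (S⇒R k q))
      ; covers     = λ e → let k , p = covers e in k , Sum.map (R⇒S k) (R⇒S k) p
      }
      where open Orients O

    disjoint-resp : Disjoint R → Disjoint S
    disjoint-resp disj k l k≢l p q =
      disj k l k≢l (S⇒R k p) (Sum.map (S⇒R l) (S⇒R l) q)

-- Exhaustive search over a finite vertex set.

module Search {V : Set} {N : ℕ} (fin : V ↪ Fin N) (G : Graph V) where
  open RightInverse fin using (to; from; strictlyInverseʳ)

  -- Every `v` is `from (to v)`, so testing all `from i` suffices.
  allV? : ∀ {P : V → Set} → U.Decidable P → Dec (∀ v → P v)
  allV? {P} P? = map′ (λ p v → subst P (strictlyInverseʳ v) (p (to v))) (λ p i → p (from i))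
                      (Fin.all? (P? ∘ from))

  module _ {m : ℕ} {R : Family V m} (R? : ∀ k → Decidable (R k)) where

    orients? : Dec (Orients G R)
    orients? = map′
      (λ (s , a , t , c) → record
        { sound      = λ k → s k _ _
        ; asym       = λ k → a k _ _
        ; transitive = λ k → t k _ _ _
        ; covers     = c _ _ })
      (λ O → let open Orients O in
        (λ k _ _ → sound k) , (λ k _ _ → asym k) , (λ k _ _ _ → transitive k) ,
        (λ _ _ → covers))
      (  Fin.all? (λ k → allV? λ u → allV? λ v → R? k u v →-dec edge? G u v)
      ×-dec Fin.all? (λ k → allV? λ u → allV? λ v → R? k u v →-dec ¬? (R? k v u))
      ×-dec Fin.all? (λ k → allV? λ u → allV? λ v → allV? λ w →
              R? k u v →-dec R? k v w →-dec R? k u w)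
      ×-dec allV? (λ u → allV? λ v →
              edge? G u v →-dec Fin.any? λ k → R? k u v ⊎-dec R? k v u))

    disjoint? : Dec (Disjoint R)
    disjoint? = map′ (λ d k l k≢l {u} {v} → d k l k≢l u v)
                     (λ d k l k≢l u v → d k l k≢l)
      (Fin.all? λ k → Fin.all? λ l → ¬? (k Fin.≟ l) →-dec
         allV? λ u → allV? λ v → R? k u v →-dec ¬? (R? l u v ⊎-dec R? l v u))

  module _ {m : ℕ} where

    -- One subset of codes for triples `(k , u , v)` describes a whole family, so a single
    -- `anySubset?` reaches every decidable family.
    decode : Subset (m * (N * N)) → Family V m
    decode S k u v = combine k (combine (to u) (to v)) ∈ S

    decode? : ∀ S k → Decidable (decode S k)
    decode? S k u v = _ ∈? S

    module _ {R : Family V m} (R? : ∀ k → Decidable (R k)) where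

      private
        At : Fin m × Fin (N * N) → Set
        At (k , ij) = let i , j = remQuot {N} N ij in R k (from i) (from j)

        At-combine : ∀ k u v →
          At (remQuot {m} (N * N) (combine k (combine (to u) (to v)))) ≡ R k u v
        At-combine k u v =
          trans (cong At (Fin.remQuot-combine k (combine (to u) (to v))))
          (trans (cong (λ (i , j) → R k (from i) (from j)) (Fin.remQuot-combine (to u) (to v)))
                 (cong₂ (R k) (strictlyInverseʳ u) (strictlyInverseʳ v)))

        at? : U.Decidable (At ∘ remQuot {m} (N * N))
        at? x = R? _ _ _

      encode : Subset (m * (N * N))
      encode = select at?

      encode⁺ : ∀ k {u v} → R k u v → decode encode k u v
      encode⁺ k {u} {v} p = ∈-select⁺ at? (subst (λ A → A) (sym (At-combine k u v)) p)

      encode⁻ : ∀ k {u v} → decode encode k u v → R k u v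
      encode⁻ k {u} {v} p = subst (λ A → A) (At-combine k u v) (∈-select⁻ at? p)

  cover? : ∀ m → Dec (ComparabilityCover G m)
  cover? m = map′
    (λ (S , O) → orients⇒cover (decode? S) O)
    (λ C → let R? = orientation? C in
      encode R? , orients-resp (encode⁺ R?) (encode⁻ R?) (cover⇒orients C))
    (anySubset? {n = m * (N * N)} λ S → orients? (decode? S))

  partition? : ∀ m → Dec (ComparabilityPartition G m)
  partition? m = map′
    (λ (S , O , D) → orients⇒partition (decode? S) O D)
    (λ P → let C = ComparabilityPartition.cover P ; R? = orientation? C in
      encode R? , orients-resp (encode⁺ R?) (encode⁻ R?) (cover⇒orients C) ,
      disjoint-resp {G = G} (encode⁺ R?) (encode⁻ R?) (partition⇒disjoint P))
    (anySubset? {n = m * (N * N)} λ S → orients? (decode? S) ×-dec disjoint? (decode? S))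

-- Partitions from levels

-- Unequal levels have a positive maximum, so 0 is reserved for edges inside a level.
color : ℕ → ℕ → ℕ
color a b with a ℕ.≟ b
... | yes _ = 0
... | no  _ = a ⊔ b

color-≡ : ∀ {a b} → a ≡ b → color a b ≡ 0
color-≡ {a} {b} a≡b with a ℕ.≟ b
... | yes _   = refl
... | no  a≢b = contradiction a≡b a≢b

color-> : ∀ {a b} → b < a → color a b ≡ a
color-> {a} {b} b<a with a ℕ.≟ b
... | yes a≡b = contradiction (sym a≡b) (ℕ.<⇒≢ b<a)
... | no  _   = ℕ.m≥n⇒m⊔n≡m (ℕ.<⇒≤ b<a)

color-comm : ∀ a b → color a b ≡ color b a
color-comm a b with a ℕ.≟ b | b ℕ.≟ a
... | yes _   | yes _   = refl
... | yes a≡b | no  b≢a = contradiction (sym a≡b) b≢a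
... | no  a≢b | yes b≡a = contradiction (sym b≡a) a≢b
... | no  _   | no  _   = ℕ.⊔-comm a b

color-< : ∀ {a b K} → a < K → b < K → color a b < K
color-< {a} {b} a<K b<K with a ℕ.≟ b
... | yes _ = ℕ.≤-<-trans z≤n a<K
... | no  _ = ℕ.⊔-lub a<K b<K

module _ {V : Set} {N : ℕ} (fin : V ↪ Fin N) (G : Graph V) (level : V → ℕ)
         (clique : ∀ {u v w} → level u ≡ level v → level v ≡ level w → u ≢ w →
                   Edge G u v → Edge G v w → Edge G u w)
         {K : ℕ} (level<K : ∀ v → level v < K) where

  private
    code : V → ℕ
    code v = toℕ (RightInverse.to fin v)

    code-injective : ∀ {u v} → code u ≡ code v → u ≡ v
    code-injective {u} {v} eq =
      trans (sym (to-from fin (Fin.toℕ-injective eq))) (RightInverse.strictlyInverseʳ fin v)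

    infix 4 _≻_
    -- A strict total order: higher level first, ties broken by the code. Every color class is
    -- oriented along it.
    _≻_ : Rel V 0ℓ
    u ≻ v = level v < level u ⊎ (level u ≡ level v × code u < code v)

    ≻-asym : Asymmetric _≻_
    ≻-asym (inj₁ p)       (inj₁ q)       = ℕ.<-asym p q
    ≻-asym (inj₁ p)       (inj₂ (q , _)) = ℕ.<⇒≢ p q
    ≻-asym (inj₂ (p , _)) (inj₁ q)       = ℕ.<⇒≢ q p
    ≻-asym (inj₂ (_ , p)) (inj₂ (_ , q)) = ℕ.<-asym p q

    ≻-connex : ∀ {u v} → u ≢ v → u ≻ v ⊎ v ≻ u
    ≻-connex {u} {v} u≢v with ℕ.<-cmp (level u) (level v)
    ... | tri< p _ _ = inj₂ (inj₁ p)
    ... | tri> _ _ p = inj₁ (inj₁ p)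
    ... | tri≈ _ p _ with ℕ.<-cmp (code u) (code v)
    ...   | tri< q _ _ = inj₁ (inj₂ (p , q))
    ...   | tri≈ _ q _ = contradiction (code-injective q) u≢v
    ...   | tri> _ _ q = inj₂ (inj₂ (sym p , q))

    ≻? : Decidable _≻_
    ≻? u v = level v ℕ.<? level u ⊎-dec (level u ℕ.≟ level v ×-dec code u ℕ.<? code v)

    edgeColor : V → V → ℕ
    edgeColor u v = color (level u) (level v)

    R : Family V K
    R k u v = Edge G u v × edgeColor u v ≡ toℕ k × u ≻ v

    R? : ∀ k → Decidable (R k)
    R? k u v = edge? G u v ×-dec edgeColor u v ℕ.≟ toℕ k ×-dec ≻? u v

    R-trans : ∀ k → Transitive (R k)
    -- Two successive drops in level start at different levels, hence have different colors.
    R-trans k (_ , c , inj₁ p) (_ , d , inj₁ q) =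
      contradiction (trans (sym (color-> q)) (trans d (trans (sym c) (color-> p)))) (ℕ.<⇒≢ p)
    -- A drop has a positive color, a step inside a level has color 0.
    R-trans k (_ , c , inj₁ p) (_ , d , inj₂ (q , _)) =
      contradiction (trans (sym (color-≡ q)) (trans d (trans (sym c) (color-> p))))
                    (ℕ.<⇒≢ (ℕ.≤-<-trans z≤n p))
    R-trans k (_ , c , inj₂ (p , _)) (_ , d , inj₁ q) =
      contradiction (trans (sym (color-≡ p)) (trans c (trans (sym d) (color-> q))))
                    (ℕ.<⇒≢ (ℕ.≤-<-trans z≤n q))
    -- Inside a level `clique` supplies the third edge; the strictly increasing codes keep its ends
    -- distinct.
    R-trans k (e , c , inj₂ (p , p′)) (f , _ , inj₂ (q , q′)) =
        clique p q (λ u≡w → ℕ.<⇒≢ u<w (cong code u≡w)) e f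
      , trans (color-≡ (trans p q)) (trans (sym (color-≡ p)) c)
      , inj₂ (trans p q , u<w)
      where u<w = ℕ.<-trans p′ q′

    R-covers : ∀ {u v} → Edge G u v → ∃[ k ] (R k u v ⊎ R k v u)
    R-covers {u} {v} e = fromℕ< c<K , oriented (≻-connex λ u≡v → irrefl G u≡v e)
      where
      c<K : edgeColor u v < K
      c<K = color-< (level<K u) (level<K v)
      c≡ : edgeColor u v ≡ toℕ (fromℕ< c<K)
      c≡ = sym (Fin.toℕ-fromℕ< c<K)
      oriented : u ≻ v ⊎ v ≻ u → _
      oriented (inj₁ p) = inj₁ (e , c≡ , p)
      oriented (inj₂ p) = inj₂ (symm G e , trans (color-comm (level v) (level u)) c≡ , p)

    R-disjoint : Disjoint R
    R-disjoint k l k≢l (_ , c , _) (inj₁ (_ , d , _)) =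
      k≢l (Fin.toℕ-injective (trans (sym c) d))
    R-disjoint k l k≢l {u} {v} (_ , c , _) (inj₂ (_ , d , _)) =
      k≢l (Fin.toℕ-injective (trans (sym c) (trans (color-comm (level u) (level v)) d)))

  levelPartition : ComparabilityPartition G K
  levelPartition = orients⇒partition R? orients R-disjoint
    where
    orients : Orients G R
    orients = record
      { sound      = λ _ → proj₁
      ; asym       = λ _ (_ , _ , p) (_ , _ , q) → ≻-asym p q
      ; transitive = R-trans
      ; covers     = R-covers
      }

-- Levels of intervals

half : ℕ → ℕ → ℕ
half zero    x = x
half (suc d) x = ⌊ half d x /2⌋

half-mono : ∀ d {x y} → x ≤ y → half d x ≤ half d y
half-mono zero    x≤y = x≤y
half-mono (suc d) x≤y = ℕ.⌊n/2⌋-mono (half-mono d x≤y)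

half-<⇒≤ : ∀ d {x y} → half d x < half d y → x ≤ y
half-<⇒≤ d p = ℕ.≮⇒≥ λ y<x → ℕ.<⇒≱ p (half-mono d (ℕ.<⇒≤ y<x))

-- Truncated subtraction absorbs the halvings made after the logarithm has reached 0.
log-half : ∀ d x → ⌊log₂ half d x ⌋ ≡ ⌊log₂ x ⌋ ∸ d
log-half zero    x = refl
log-half (suc d) x = trans (⌊log₂⌊n/2⌋⌋≡⌊log₂n⌋∸1 (half d x))
  (trans (cong (_∸ 1) (log-half d x))
  (trans (ℕ.∸-+-assoc ⌊log₂ x ⌋ d 1) (cong (⌊log₂ x ⌋ ∸_) (ℕ.+-comm d 1))))

log≡0⇒⌊n/2⌋≡0 : ∀ n → ⌊log₂ n ⌋ ≡ 0 → ⌊ n /2⌋ ≡ 0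
log≡0⇒⌊n/2⌋≡0 0             _  = refl
log≡0⇒⌊n/2⌋≡0 1             _  = refl
log≡0⇒⌊n/2⌋≡0 (suc (suc n)) eq =
  contradiction (sym eq) (ℕ.<⇒≢ (⌊log₂⌋-mono-≤ {2} {suc (suc n)} (s≤s (s≤s z≤n))))

-- After `⌊log₂ n ⌋` halvings the logarithm is 0, so the value is at most 1 and one more halving
-- gives 0.
half-log≡0 : ∀ {x n} → x ≤ n → half (suc ⌊log₂ n ⌋) x ≡ 0
half-log≡0 {x} {n} x≤n = log≡0⇒⌊n/2⌋≡0 (half ⌊log₂ n ⌋ x)
  (trans (log-half ⌊log₂ n ⌋ x) (ℕ.m≤n⇒m∸n≡0 (⌊log₂⌋-mono-≤ x≤n)))

-- If d ≤ a then 2 + c ≤ b, so the halves of b and c differ.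
same-half-< : ∀ {a b c d} → a < b → c < d → ⌊ b /2⌋ ≡ ⌊ c /2⌋ → a < d
same-half-< {a} {b} {c} {d} a<b c<d eq = ℕ.≰⇒> λ d≤a →
  ℕ.<⇒≢ (ℕ.⌊n/2⌋-mono (ℕ.≤-trans (s≤s (ℕ.≤-trans c<d d≤a)) a<b)) (sym eq)

module _ {n : ℕ} where

  -- The shift to `suc ℓ` makes the least such `ℓ` the last stage at which the endpoints still
  -- differ.
  Merged : Interval n → ℕ → Set
  Merged I ℓ = half (suc ℓ) (lo I) ≡ half (suc ℓ) (hi I)

  merged-log : ∀ I → Merged I ⌊log₂ n ⌋
  merged-log I = trans (half-log≡0 {n = n} (ℕ.≤-trans (ℕ.<⇒≤ (lo<hi I)) (hi≤n I)))
                       (sym (half-log≡0 {n = n} (hi≤n I)))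

  leastMerged : ∀ I → ∃[ ℓ ] IsMinimum (Merged I) ℓ
  leastMerged I = least {P = Merged I} (λ _ → _ ℕ.≟ _) {⌊log₂ n ⌋} (merged-log I)

  level : Interval n → ℕ
  level I = proj₁ (leastMerged I)

  merged : ∀ I → Merged I (level I)
  merged I = proj₁ (proj₂ (leastMerged I))

  level< : ∀ I → level I < ⌊log₂ n ⌋ + 1
  level< I = ℕ.≤-<-trans (proj₂ (proj₂ (leastMerged I)) _ (merged-log I))
                         (ℕ.m<m+n ⌊log₂ n ⌋ (s≤s z≤n))

  -- At a level `suc ℓ`, equality would be `Merged I ℓ`, against minimality; at level 0 nothing has
  -- been halved yet.
  unmerged : ∀ I → half (level I) (lo I) < half (level I) (hi I)
  unmerged I with leastMerged I
  ... | zero  , _ , _   = lo<hi I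
  ... | suc ℓ , _ , min = ℕ.≤∧≢⇒< (half-mono (suc ℓ) (ℕ.<⇒≤ (lo<hi I)))
                                   (λ m → ℕ.1+n≰n (min ℓ m))

  -- By `merged`, `hi I` gives the same number. Within a level, centers label the cliques.
  center : Interval n → ℕ
  center I = half (suc (level I)) (lo I)

  -- Halving is monotone, and `merged J` turns the image of `hi J` into `center J`.
  intersect⇒center-≤ : ∀ I J → level I ≡ level J → lo I ≤ hi J → center I ≤ center J
  intersect⇒center-≤ I J eq p =
    subst (λ ℓ → center I ≤ half (suc ℓ) (lo J)) eq
      (ℕ.≤-trans (half-mono (suc (level I)) p)
        (ℕ.≤-reflexive (subst (λ ℓ → half (suc ℓ) (hi J) ≡ half (suc ℓ) (lo J)) (sym eq)
          (sym (merged J)))))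

  -- One halving before the endpoints merge, `same-half-<` puts the image of `lo I` strictly below
  -- that of `hi J`; `half-<⇒≤` lifts this back to the endpoints themselves.
  center-≡⇒lo≤hi : ∀ I J → level I ≡ level J → center I ≡ center J → lo I ≤ hi J
  center-≡⇒lo≤hi I J eq c = half-<⇒≤ (level I) (same-half-< (unmerged I)
    (subst (λ ℓ → half ℓ (lo J) < half ℓ (hi J)) (sym eq) (unmerged J))
    (trans (sym (merged I)) (trans c (cong (λ ℓ → half (suc ℓ) (lo J)) (sym eq)))))

  intersect⇒center-≡ : ∀ I J → level I ≡ level J → Intersect I J → center I ≡ center J
  intersect⇒center-≡ I J eq x = let p , q = intersect⁻ I J x in
    ℕ.≤-antisym (intersect⇒center-≤ I J eq p) (intersect⇒center-≤ J I (sym eq) q)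

  -- Within a level, meeting amounts to having equal centers, which is a transitive relation.
  level-clique : ∀ {I J L} → level I ≡ level J → level J ≡ level L → I ≢ L →
    Edge (intervalGraph n) I J → Edge (intervalGraph n) J L → Edge (intervalGraph n) I L
  level-clique {I} {J} {L} p q I≢L (_ , x) (_ , y) = I≢L , intersect⁺ I L
    (center-≡⇒lo≤hi I L (trans p q) c , center-≡⇒lo≤hi L I (sym (trans p q)) (sym c))
    where
    c : center I ≡ center L
    c = trans (intersect⇒center-≡ I J p x) (intersect⇒center-≡ J L q y)

-- Finiteness of the vertex set.

Interval-finite : ∀ {n} → 2 ≤ n → Interval n ↪ Fin (suc n * suc n)
Interval-finite {n} 2≤n = mk↪ {to = to} {from = from} λ { refl → from-to _ }
  where
  make : ℕ → ℕ → Interval n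
  make i j with 1 ℕ.≤? i ×-dec i ℕ.<? j ×-dec j ℕ.≤? n
  ... | yes (p , q , r) = interval i j p q r
  -- Pairs that bound no interval decode to the default `[1 , 2]`, which exists because `2 ≤ n`.
  ... | no  _           = interval 1 2 ℕ.≤-refl ℕ.≤-refl 2≤n

  make-lo-hi : ∀ I → make (lo I) (hi I) ≡ I
  make-lo-hi I with 1 ℕ.≤? lo I ×-dec lo I ℕ.<? hi I ×-dec hi I ℕ.≤? n
  ... | yes _ = ≡-interval refl refl
  ... | no ¬p = contradiction (1≤lo I , lo<hi I , hi≤n I) ¬p

  lo< : ∀ I → lo I < suc n
  lo< I = s≤s (ℕ.≤-trans (ℕ.<⇒≤ (lo<hi I)) (hi≤n I))

  to : Interval n → Fin (suc n * suc n)
  to I = combine (fromℕ< (lo< I)) (fromℕ< (s≤s (hi≤n I)))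

  from : Fin (suc n * suc n) → Interval n
  from x = let i , j = remQuot {suc n} (suc n) x in make (toℕ i) (toℕ j)

  from-to : ∀ I → from (to I) ≡ I
  from-to I =
    trans (cong (λ (i , j) → make (toℕ i) (toℕ j))
                (Fin.remQuot-combine (fromℕ< (lo< I)) (fromℕ< (s≤s (hi≤n I)))))
    (trans (cong₂ make (Fin.toℕ-fromℕ< (lo< I)) (Fin.toℕ-fromℕ< (s≤s (hi≤n I))))
           (make-lo-hi I))

theorem8 : ∀ (n : ℕ) → 2 ≤ n →
    ∃[ c ] ∃[ p ] (IsC (intervalGraph n) c × IsP (intervalGraph n) p ×
    c ≤ p × p ≤ ⌊log₂ n ⌋ + 1)
theorem8 n 2≤n =
  let fin = Interval-finite 2≤n
      open Search fin (intervalGraph n)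
      P = levelPartition fin (intervalGraph n) level level-clique level<
      c , C , c-min = least cover? (ComparabilityPartition.cover P)
      p , Q , p-min = least partition? P
  in c , p , (C , c-min) , (Q , p-min) ,
     -- A minimum partition is in particular a cover, whence `c ≤ p`; the level partition bounds
     -- `p`.
     c-min p (ComparabilityPartition.cover Q) , p-min _ P
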